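{- Let $G$ be a multigraph whose underlying simple graph is $K_4$. Let $u\in V(G)$ and write $V(G)\setminus\{u\}=\{v_1,v_2,v_3\}$. Then: (i) $G$ is $K_3$-decomposable if and only if there exists an integer $n$ with $0\le n\le \min\{\mu(v_i,v_j): i,j\in\{1,2,3\}, i\ne j\}$ such that $\mu(u,v_i)=\mu(v_i,v_j)+\mu(v_i,v_k)-2n$ for every $i\in\{1,2,3\}$, where $\{j,k\}=\{1,2,3\}\setminus\{i\}$; (ii) $G$ is rationally $K_3$-decomposable if and only if there exists an integer $n'$ with $0\le \tfrac{n'}{2}\le \min\{\mu(v_i,v_j): i,j\in\{1,2,3\}, i\ne j\}$ such that $\mu(u,v_i)=\mu(v_i,v_j)+\mu(v_i,v_k)-n'$ for every $i\in\{1,2,3\}$, where $\{j,k\}=\{1,2,3\}\setminus\{i\}$. Moreover, if $G$ is rationally $K_3$-decomposable, then it has a rational $K_3$-decomposition using only weights $0$, $1$ and $\tfrac12$.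
   Context: A multigraph may have multiple edges but no loops; $\mu(x,y)$ denotes the number of edges joining vertices $x$ and $y$ (so here $\mu(x,y)\ge1$ for all distinct $x,y$). A triangle of a multigraph is a set of three edges joining three vertices pairwise (different choices of parallel edges give different triangles). $G$ is $K_3$-decomposable if its edge set can be partitioned into triangles. A rational $K_3$-decomposition is an assignment of nonnegative rational weights to the triangles of $G$ such that for every edge $e$, the sum of the weights of the triangles containing $e$ equals $1$; $G$ is rationally $K_3$-decomposable if such an assignment exists. -}

module Defs where

open import Data.Nat using (ℕ)
open import Data.Fin using (Fin; _<_; _<?_)
import Data.Fin.Properties as FinP
open import Data.Product using (Σ; Σ-syntax; _×_; _,_; ∃!)
import Data.Product.Properties as ProdP
open import Data.Sum using (_⊎_)
open import Data.Bool using (Bool; true)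
open import Data.List using (List; map; concatMap; allFin; filter; foldr)
open import Data.Rational using (ℚ; 0ℚ; 1ℚ; _+_; _≤_)
open import Relation.Binary.PropositionalEquality using (_≡_)
open import Relation.Nullary using (Dec)
open import Relation.Nullary.Decidable using (_×-dec_; _⊎-dec_)

-- A multigraph whose underlying simple graph is K₄: vertex set Fin 4,
-- multiplicity function μ (assumed symmetric and ≥ 1 off the diagonal
-- in the theorem).  Values μ x x are irrelevant (no loops).
Mult : Set
Mult = Fin 4 → Fin 4 → ℕ

module _ (μ : Mult) where

  -- A candidate edge: endpoints x, y and the index of the parallel edge.
  -- Genuine edges are those with x < y (each unordered pair once).
  Edge : Set
  Edge = Σ[ x ∈ Fin 4 ] Σ[ y ∈ Fin 4 ] Fin (μ x y)

  IsEdge : Edge → Set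
  IsEdge (x , y , _) = x < y

  -- A candidate triangle: vertices a, b, c and a choice of parallel edge
  -- for each of ab, ac, bc.  Genuine triangles have a < b < c.
  Triangle : Set
  Triangle = Σ[ a ∈ Fin 4 ] Σ[ b ∈ Fin 4 ] Σ[ c ∈ Fin 4 ]
               (Fin (μ a b) × Fin (μ a c) × Fin (μ b c))

  IsTriangle : Triangle → Set
  IsTriangle (a , b , c , _) = a < b × b < c

  isTriangle? : (t : Triangle) → Dec (IsTriangle t)
  isTriangle? (a , b , c , _) = (a <? b) ×-dec (b <? c)

  edgeAB edgeAC edgeBC : Triangle → Edge
  edgeAB (a , b , c , i , j , k) = a , b , i
  edgeAC (a , b , c , i , j , k) = a , c , j
  edgeBC (a , b , c , i , j , k) = b , c , k

  _∈ᵗ_ : Edge → Triangle → Set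
  e ∈ᵗ t = e ≡ edgeAB t ⊎ e ≡ edgeAC t ⊎ e ≡ edgeBC t

  edge-≟ : (e f : Edge) → Dec (e ≡ f)
  edge-≟ = ProdP.≡-dec FinP._≟_ (ProdP.≡-dec FinP._≟_ FinP._≟_)

  _∈ᵗ?_ : (e : Edge) → (t : Triangle) → Dec (e ∈ᵗ t)
  e ∈ᵗ? t = edge-≟ e (edgeAB t) ⊎-dec (edge-≟ e (edgeAC t) ⊎-dec edge-≟ e (edgeBC t))

  allTriangles : List Triangle
  allTriangles =
    concatMap (λ a → concatMap (λ b → concatMap (λ c →
      concatMap (λ i → concatMap (λ j → map (λ k → a , b , c , i , j , k)
        (allFin (μ b c))) (allFin (μ a c))) (allFin (μ a b)))
      (allFin 4)) (allFin 4)) (allFin 4)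

  trianglesThrough : Edge → List Triangle
  trianglesThrough e = filter (λ t → isTriangle? t ×-dec (e ∈ᵗ? t)) allTriangles

  sumℚ : List ℚ → ℚ
  sumℚ = foldr _+_ 0ℚ

  K3Decomposable : Set
  K3Decomposable =
    Σ[ S ∈ (Triangle → Bool) ]
      ((∀ t → S t ≡ true → IsTriangle t) ×
       (∀ e → IsEdge e → ∃! _≡_ (λ t → S t ≡ true × e ∈ᵗ t)))

  IsRationalK3Decomposition : (Triangle → ℚ) → Set
  IsRationalK3Decomposition w =
    (∀ t → 0ℚ ≤ w t) ×
    (∀ e → IsEdge e → sumℚ (map w (trianglesThrough e)) ≡ 1ℚ)

  RationallyK3Decomposable : Set
  RationallyK3Decomposable = Σ[ w ∈ (Triangle → ℚ) ] IsRationalK3Decomposition w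

{-# OPTIONS --safe #-}

-- For a rational decomposition let X d be the total weight of the triangles that avoid the vertex d.
-- If {a, b, c, d} is the vertex set, the triangles with side ab are those avoiding c or d, so summing
-- over the parallel edges ab gives μ a b = X c + X d. Hence μ u x = μ x y + μ x z − 2 X u and
-- X u ≤ μ x y, which is the condition with n′ = 2 X u; in an integral decomposition X u is itself an
-- integer n.
--
-- Conversely, the condition determines natural numbers m d and ε ∈ {0, 1} with ε ≡ n′ (mod 2) and
-- μ a b = m c + m d + ε. So one can take m d triangles of weight 1 avoiding d for each vertex d, and,
-- if ε = 1, the remaining edges form one copy of K₄, whose four triangles receive weight ½.
module Submission where

open import Data.Nat as ℕ using (ℕ; zero; suc; _+_; _*_; _∸_; _≤_; s≤s)
import Data.Nat.Properties as ℕₚ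
open import Data.Nat.DivMod using (_/_; _%_; m≡m%n+[m/n]*n; m%n<n)
open import Data.Nat.Tactic.RingSolver using (solve-∀)
open import Algebra.Properties.CommutativeSemigroup ℕₚ.+-commutativeSemigroup using (x∙yz≈y∙xz)
open import Data.Fin as F using (Fin; toℕ; fromℕ<)
import Data.Fin.Properties as Fₚ
open Fₚ using (_≟_; _<?_; all?; any?)
open import Data.Product using (_×_; _,_; ∃-syntax; Σ-syntax; ∃!; proj₁; proj₂)
import Data.Product.Properties as Productₚ
open import Data.Sum using (_⊎_; inj₁; inj₂)
open import Data.Bool using (true; false; if_then_else_)
import Data.Sum as Sum
import Data.Sum.Properties as Sumₚ
import Data.Bool.Properties as Boolₚ
open import Data.Empty using (⊥-elim)
open import Data.List using (List; []; _∷_; map; concatMap; allFin; filter; foldr; length)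
import Data.List.Properties as Listₚ
import Data.List.Relation.Unary.All as All
open import Data.List.Relation.Unary.Any using (here; there)
open import Data.List.Membership.Propositional using (_∈_; find; lose)
open import Data.List.Membership.Propositional.Properties
  using (∈-allFin; ∈-filter⁺; ∈-filter⁻; ∈-map⁺; ∈-map⁻; ∈-concatMap⁺; ∈-concatMap⁻)
open import Data.List.Relation.Unary.Unique.Propositional using (Unique; []; _∷_)
import Data.List.Relation.Unary.Unique.Propositional.Properties as Uniqueₚ
open import Data.Rational as ℚ using (ℚ; 0ℚ; 1ℚ; ½)
import Data.Rational.Properties as ℚₚ
open import Algebra.Bundles using (CommutativeMonoid)
open import Algebra.Properties.Monoid.Mult ℚₚ.+-0-monoid using (×-homo-+) renaming (_×_ to _·_)
open import Algebra.Properties.AbelianGroup ℚₚ.+-0-abelianGroup using (∙-cancelˡ)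
open import Algebra.Properties.CommutativeSemigroup
  (CommutativeMonoid.commutativeSemigroup ℚₚ.+-0-commutativeMonoid) using (interchange)
open import Function.Base using (_∘_)
open import Function.Bundles using (_⇔_; mk⇔)
open import Relation.Binary.Definitions using (tri<; tri≈; tri>)
open import Relation.Binary.PropositionalEquality
  using (_≡_; _≢_; ≢-sym; refl; sym; trans; cong; cong₂; subst; module ≡-Reasoning)
open import Relation.Nullary using (¬_; Dec; yes; no; does; ¬?; _×-dec_; _⊎-dec_; _→-dec_)
open import Relation.Nullary.Decidable using (toWitness; dec-true; dec-false)
open import Defs

-- Incidence of edges and triangles on four vertices.

Distinct : (a b c d : Fin 4) → Set
Distinct a b c d = a ≢ b × a ≢ c × a ≢ d × b ≢ c × b ≢ d × c ≢ d

Avoids : (d a b c : Fin 4) → Set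
Avoids d a b c = d ≢ a × d ≢ b × d ≢ c

Sorted : (a b c : Fin 4) → Set
Sorted a b c = a F.< b × b F.< c

Side : (a b x y z : Fin 4) → Set
Side a b x y z = (a ≡ x × b ≡ y) ⊎ (a ≡ x × b ≡ z) ⊎ (a ≡ y × b ≡ z)

side-avoids : ∀ {a b x y z d} → Side a b x y z → Avoids d x y z → d ≢ a × d ≢ b
side-avoids (inj₁ (refl , refl))        (dx , dy , dz) = dx , dy
side-avoids (inj₂ (inj₁ (refl , refl))) (dx , dy , dz) = dx , dz
side-avoids (inj₂ (inj₂ (refl , refl))) (dx , dy , dz) = dy , dz

_≢?_ : (a b : Fin 4) → Dec (a ≢ b)
a ≢? b = ¬? (a ≟ b)

distinct? : ∀ a b c d → Dec (Distinct a b c d)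
distinct? a b c d =
  a ≢? b ×-dec a ≢? c ×-dec a ≢? d ×-dec b ≢? c ×-dec b ≢? d ×-dec c ≢? d

avoids? : ∀ d a b c → Dec (Avoids d a b c)
avoids? d a b c = d ≢? a ×-dec d ≢? b ×-dec d ≢? c

sorted? : ∀ a b c → Dec (Sorted a b c)
sorted? a b c = (a <? b) ×-dec (b <? c)

side? : ∀ a b x y z → Dec (Side a b x y z)
side? a b x y z = (a ≟ x ×-dec b ≟ y) ⊎-dec (a ≟ x ×-dec b ≟ z) ⊎-dec (a ≟ y ×-dec b ≟ z)

-- Opaque, because `with` would otherwise normalise the decision procedures.
opaque

  -- A triangle in K₄ misses exactly one vertex, so it has the side ab iff that vertex is `c` or
  -- `d`. The three exclusive cases make the indicator of the side ab the sum of two avoidance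
  -- indicators.
  side-or-not : ∀ a b → a F.< b → ∀ x y z → Sorted x y z → ∀ c d → Distinct a b c d →
    (Avoids c x y z × ¬ Avoids d x y z × Side a b x y z) ⊎
    (¬ Avoids c x y z × Avoids d x y z × Side a b x y z) ⊎
    (¬ Avoids c x y z × ¬ Avoids d x y z × ¬ Side a b x y z)
  side-or-not = toWitness
    {a? = all? λ a → all? λ b → (a <? b) →-dec all? λ x → all? λ y → all? λ z → sorted? x y z →-dec
          all? λ c → all? λ d → distinct? a b c d →-dec
          ((avoids? c x y z ×-dec ¬? (avoids? d x y z) ×-dec side? a b x y z) ⊎-dec
           (¬? (avoids? c x y z) ×-dec avoids? d x y z ×-dec side? a b x y z) ⊎-dec
           (¬? (avoids? c x y z) ×-dec ¬? (avoids? d x y z) ×-dec ¬? (side? a b x y z)))} _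

  avoids-unique : ∀ a b c → Sorted a b c → ∀ d e → Avoids d a b c → Avoids e a b c → d ≡ e
  avoids-unique = toWitness
    {a? = all? λ a → all? λ b → all? λ c → sorted? a b c →-dec
          all? λ d → all? λ e → avoids? d a b c →-dec (avoids? e a b c →-dec (d ≟ e))} _

  sorted-unique : ∀ a b c → Sorted a b c → ∀ x y z → Sorted x y z →
    ∀ d → Avoids d a b c → Avoids d x y z → a ≡ x × b ≡ y × c ≡ z
  sorted-unique = toWitness
    {a? = all? λ a → all? λ b → all? λ c → sorted? a b c →-dec
          all? λ x → all? λ y → all? λ z → sorted? x y z →-dec
          all? λ d → avoids? d a b c →-dec
            (avoids? d x y z →-dec (a ≟ x ×-dec b ≟ y ×-dec c ≟ z))} _

  avoided : ∀ a b c → Sorted a b c → ∃[ d ] Avoids d a b c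
  avoided = toWitness
    {a? = all? λ a → all? λ b → all? λ c → sorted? a b c →-dec any? λ d → avoids? d a b c} _

  avoiding : ∀ d → ∃[ a ] ∃[ b ] ∃[ c ] (Sorted a b c × Avoids d a b c)
  avoiding = toWitness
    {a? = all? λ d → any? λ a → any? λ b → any? λ c → sorted? a b c ×-dec avoids? d a b c} _

  avoiding-side : ∀ a b c → Sorted a b c → ∀ x y → x F.< y →
    ∀ d → Avoids d a b c → d ≢ x → d ≢ y → Side x y a b c
  avoiding-side = toWitness
    {a? = all? λ a → all? λ b → all? λ c → sorted? a b c →-dec
          all? λ x → all? λ y → (x <? y) →-dec
          all? λ d → avoids? d a b c →-dec (d ≢? x →-dec (d ≢? y →-dec side? x y a b c))} _

  fourth : ∀ a b c → a ≢ b → a ≢ c → b ≢ c → ∃[ d ] Distinct a b c d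
  fourth = toWitness
    {a? = all? λ a → all? λ b → all? λ c → a ≢? b →-dec (a ≢? c →-dec (b ≢? c →-dec
          any? λ d → distinct? a b c d))} _

  exhaust : ∀ a b c d → Distinct a b c d → ∀ x → x ≡ a ⊎ x ≡ b ⊎ x ≡ c ⊎ x ≡ d
  exhaust = toWitness
    {a? = all? λ a → all? λ b → all? λ c → all? λ d → distinct? a b c d →-dec
          all? λ x → x ≟ a ⊎-dec x ≟ b ⊎-dec x ≟ c ⊎-dec x ≟ d} _

-- The junk value (a , a) is only attained on the diagonal.
complement : Fin 4 → Fin 4 → Fin 4 × Fin 4
complement a b with filter (λ x → x ≢? a ×-dec x ≢? b) (allFin 4)
... | c ∷ d ∷ [] = c , d
... | _          = a , a

opaque

  complement-distinct : ∀ a b → a ≢ b → Distinct a b (proj₁ (complement a b)) (proj₂ (complement a b))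
  complement-distinct = toWitness
    {a? = all? λ a → all? λ b → a ≢? b →-dec
          distinct? a b (proj₁ (complement a b)) (proj₂ (complement a b))} _

rotate : ∀ {a b c d} → Distinct a b c d → Distinct c d a b
rotate (ab , ac , ad , bc , bd , cd) =
  cd , (λ e → ac (sym e)) , (λ e → bc (sym e)) , (λ e → ad (sym e)) , (λ e → bd (sym e)) , ab

-- Finite sums of rationals.

private
  variable
    A B : Set

∑ : List A → (A → ℚ) → ℚ
∑ xs f = foldr ℚ._+_ 0ℚ (map f xs)

-- The Iverson bracket times `q`. It turns a sum over a filtered list into one over the whole list,
-- where the order of summation can be exchanged.
[_]_ : {P : Set} → Dec P → ℚ → ℚ
[ P? ] q = if does P? then q else 0ℚ

[]-true : {P : Set} (P? : Dec P) {q : ℚ} → P → [ P? ] q ≡ q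
[]-true P? p rewrite dec-true P? p = refl

[]-false : {P : Set} (P? : Dec P) {q : ℚ} → ¬ P → [ P? ] q ≡ 0ℚ
[]-false P? ¬p rewrite dec-false P? ¬p = refl

[]-0≤ : {P : Set} (P? : Dec P) {q : ℚ} → 0ℚ ℚ.≤ q → 0ℚ ℚ.≤ [ P? ] q
[]-0≤ P? 0≤q with does P?
... | true  = 0≤q
... | false = ℚₚ.≤-refl

∑-cong : {f g : A → ℚ} (xs : List A) → (∀ x → f x ≡ g x) → ∑ xs f ≡ ∑ xs g
∑-cong []       f≗g = refl
∑-cong (x ∷ xs) f≗g = cong₂ ℚ._+_ (f≗g x) (∑-cong xs f≗g)

∑-0≤ : {f : A → ℚ} (xs : List A) → (∀ x → 0ℚ ℚ.≤ f x) → 0ℚ ℚ.≤ ∑ xs f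
∑-0≤ []       0≤f = ℚₚ.≤-refl
∑-0≤ (x ∷ xs) 0≤f = ℚₚ.+-mono-≤ (0≤f x) (∑-0≤ xs 0≤f)

∑-0 : {f : A → ℚ} (xs : List A) → (∀ x → x ∈ xs → f x ≡ 0ℚ) → ∑ xs f ≡ 0ℚ
∑-0 []       f≡0 = refl
∑-0 (x ∷ xs) f≡0 = cong₂ ℚ._+_ (f≡0 x (here refl)) (∑-0 xs λ y y∈xs → f≡0 y (there y∈xs))

∑-+ : (f g : A → ℚ) (xs : List A) → ∑ xs (λ x → f x ℚ.+ g x) ≡ ∑ xs f ℚ.+ ∑ xs g
∑-+ f g []       = refl
∑-+ f g (x ∷ xs) = trans (cong (f x ℚ.+ g x ℚ.+_) (∑-+ f g xs)) (interchange (f x) (g x) _ _)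

∑-filter : {P : A → Set} (P? : ∀ x → Dec (P x)) (f : A → ℚ) (xs : List A) →
  ∑ (filter P? xs) f ≡ ∑ xs (λ x → [ P? x ] f x)
∑-filter P? f []       = refl
∑-filter P? f (x ∷ xs) with does (P? x)
... | true  = cong (f x ℚ.+_) (∑-filter P? f xs)
... | false = trans (∑-filter P? f xs) (sym (ℚₚ.+-identityˡ _))

∑-swap : (f : A → B → ℚ) (xs : List A) (ys : List B) →
  ∑ xs (λ x → ∑ ys (f x)) ≡ ∑ ys (λ y → ∑ xs (λ x → f x y))
∑-swap f []       ys = sym (∑-0 ys λ _ _ → refl)
∑-swap f (x ∷ xs) ys =
  trans (cong (∑ ys (f x) ℚ.+_) (∑-swap f xs ys)) (sym (∑-+ (f x) _ ys))

∑-const : (q : ℚ) (xs : List A) → ∑ xs (λ _ → q) ≡ length xs · q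
∑-const q []       = refl
∑-const q (x ∷ xs) = cong (q ℚ.+_) (∑-const q xs)

∑-single : {f : A → ℚ} {xs : List A} {a : A} → Unique xs → a ∈ xs →
  (∀ x → x ∈ xs → x ≢ a → f x ≡ 0ℚ) → ∑ xs f ≡ f a
∑-single {f = f} {xs = x ∷ xs} (x∉xs ∷ u) (here refl) f≡0 =
  trans (cong (f x ℚ.+_) (∑-0 xs λ y y∈xs → f≡0 y (there y∈xs) (λ y≡x → All.lookup x∉xs y∈xs (sym y≡x))))
        (ℚₚ.+-identityʳ (f x))
∑-single {f = f} {xs = x ∷ xs} (x∉xs ∷ u) (there a∈xs) f≡0 =
  trans (cong₂ ℚ._+_ (f≡0 x (here refl) (All.lookup x∉xs a∈xs))
                     (∑-single u a∈xs λ y y∈xs → f≡0 y (there y∈xs)))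
        (ℚₚ.+-identityˡ _)

-- For edges of half colour, whose total weight comes from two triangles.
∑-double : {f : A → ℚ} {xs : List A} {a b : A} → Unique xs → a ∈ xs → b ∈ xs → a ≢ b →
  (∀ x → x ∈ xs → x ≢ a → x ≢ b → f x ≡ 0ℚ) → ∑ xs f ≡ f a ℚ.+ f b
∑-double u (here refl) (here refl) a≢b f≡0 = ⊥-elim (a≢b refl)
∑-double {f = f} (x∉xs ∷ u) (here refl) (there b∈xs) a≢b f≡0 = cong (f _ ℚ.+_)
  (∑-single u b∈xs λ y y∈xs → f≡0 y (there y∈xs) (λ y≡x → All.lookup x∉xs y∈xs (sym y≡x)))
∑-double {f = f} {a = a} {b = b} (x∉xs ∷ u) (there a∈xs) (here refl) a≢b f≡0 = trans (cong (f _ ℚ.+_)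
  (∑-single u a∈xs λ y y∈xs y≢a → f≡0 y (there y∈xs) y≢a (λ y≡x → All.lookup x∉xs y∈xs (sym y≡x))))
  (ℚₚ.+-comm (f b) (f a))
∑-double (x∉xs ∷ u) (there a∈xs) (there b∈xs) a≢b f≡0 =
  trans (cong₂ ℚ._+_ (f≡0 _ (here refl) (All.lookup x∉xs a∈xs) (All.lookup x∉xs b∈xs))
                     (∑-double u a∈xs b∈xs a≢b λ y y∈xs → f≡0 y (there y∈xs)))
        (ℚₚ.+-identityˡ _)

concatMap⁻ : (f : A → List B) (xs : List A) {y : B} → y ∈ concatMap f xs → ∃[ x ] y ∈ f x
concatMap⁻ f xs y∈ = let x , _ , y∈fx = find (∈-concatMap⁻ f {xs = xs} y∈) in x , y∈fx

concatMap⁺ : (f : A → List B) {xs : List A} → Unique xs → (∀ x → Unique (f x)) →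
  (∀ {x y z} → z ∈ f x → z ∈ f y → x ≡ y) → Unique (concatMap f xs)
concatMap⁺ f []       uf inj = []
concatMap⁺ f {x ∷ xs} (x∉xs ∷ u) uf inj = Uniqueₚ.++⁺ (uf x) (concatMap⁺ f u uf inj)
  λ (z∈fx , z∈rest) → let y , y∈xs , z∈fy = find (∈-concatMap⁻ f z∈rest) in
    All.lookup x∉xs y∈xs (inj z∈fx z∈fy)

-- The embedding of the natural numbers into the rationals.

0≤n·1 : ∀ n → 0ℚ ℚ.≤ n · 1ℚ
0≤n·1 zero    = ℚₚ.≤-refl
0≤n·1 (suc n) = ℚₚ.+-mono-≤ {0ℚ} {1ℚ} (toWitness {a? = 0ℚ ℚₚ.≤? 1ℚ} _) (0≤n·1 n)

·1-mono-< : ∀ {m n} → m ℕ.< n → m · 1ℚ ℚ.< n · 1ℚ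
·1-mono-< {zero}  {suc n} _         = ℚₚ.+-mono-<-≤ {0ℚ} {1ℚ} (toWitness {a? = 0ℚ ℚₚ.<? 1ℚ} _) (0≤n·1 n)
·1-mono-< {suc m} {suc n} (s≤s m<n) = ℚₚ.+-monoʳ-< 1ℚ (·1-mono-< m<n)

·1-cancel-≤ : ∀ m n → m · 1ℚ ℚ.≤ n · 1ℚ → m ≤ n
·1-cancel-≤ m n m≤n = ℕₚ.≮⇒≥ λ n<m → ℚₚ.<-irrefl refl (ℚₚ.<-≤-trans (·1-mono-< n<m) m≤n)

·1-injective : ∀ m n → m · 1ℚ ≡ n · 1ℚ → m ≡ n
·1-injective m n e =
  ℕₚ.≤-antisym (·1-cancel-≤ m n (ℚₚ.≤-reflexive e)) (·1-cancel-≤ n m (ℚₚ.≤-reflexive (sym e)))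

p≤p+q : ∀ p {q} → 0ℚ ℚ.≤ q → p ℚ.≤ p ℚ.+ q
p≤p+q p {q} 0≤q = subst (ℚ._≤ p ℚ.+ q) (ℚₚ.+-identityʳ p) (ℚₚ.+-monoʳ-≤ p 0≤q)

-- Nonnegativity of `q` forces `m ≤ n`, so the truncated difference `n ∸ m` is exact.
·1-subtract : ∀ m n {q} → 0ℚ ℚ.≤ q → m · 1ℚ ℚ.+ q ≡ n · 1ℚ → ∃[ k ] k · 1ℚ ≡ q
·1-subtract m n {q} 0≤q e = n ∸ m , ∙-cancelˡ (m · 1ℚ) _ _ (begin
  m · 1ℚ ℚ.+ (n ∸ m) · 1ℚ ≡⟨ ×-homo-+ 1ℚ m (n ∸ m) ⟨
  (m + (n ∸ m)) · 1ℚ      ≡⟨ cong (_· 1ℚ) (ℕₚ.m+[n∸m]≡n m≤n) ⟩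
  n · 1ℚ                  ≡⟨ e ⟨
  m · 1ℚ ℚ.+ q            ∎)
  where
  open ≡-Reasoning
  m≤n : m ≤ n
  m≤n = ·1-cancel-≤ m n (subst (m · 1ℚ ℚ.≤_) e (p≤p+q _ 0≤q))

Natural : ℚ → Set
Natural q = ∃[ n ] n · 1ℚ ≡ q

∑-natural : {f : A → ℚ} (xs : List A) → (∀ x → Natural (f x)) → Natural (∑ xs f)
∑-natural []       nat = 0 , refl
∑-natural (x ∷ xs) nat =
  let m , p = nat x ; n , q = ∑-natural xs nat in m + n , trans (×-homo-+ 1ℚ m n) (cong₂ ℚ._+_ p q)

-- The list of candidate triangles is complete and free of repetitions.

module _ (μ : Mult) where

  private
    -- The nested levels of `allTriangles`; the subscript counts the coordinates held fixed.
    T₅ : ∀ a b c → Fin (μ a b) → Fin (μ a c) → List (Triangle μ)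
    T₅ a b c i j = map (λ k → a , b , c , i , j , k) (allFin (μ b c))

    T₄ : ∀ a b c → Fin (μ a b) → List (Triangle μ)
    T₄ a b c i = concatMap (T₅ a b c i) (allFin (μ a c))

    T₃ : ∀ a b c → List (Triangle μ)
    T₃ a b c = concatMap (T₄ a b c) (allFin (μ a b))

    T₂ : ∀ a b → List (Triangle μ)
    T₂ a b = concatMap (T₃ a b) (allFin 4)

    T₁ : ∀ a → List (Triangle μ)
    T₁ a = concatMap (T₂ a) (allFin 4)

    ∈T₅ : ∀ a b c i j {t} → t ∈ T₅ a b c i j → ∃[ k ] t ≡ (a , b , c , i , j , k)
    ∈T₅ a b c i j t∈ = let k , _ , e = ∈-map⁻ (λ k → a , b , c , i , j , k) t∈ in k , e

    ∈T₄ : ∀ a b c i {t} → t ∈ T₄ a b c i → ∃[ jk ] t ≡ (a , b , c , i , jk)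
    ∈T₄ a b c i t∈ =
      let j , t∈′ = concatMap⁻ (T₅ a b c i) (allFin (μ a c)) t∈ ; k , e = ∈T₅ a b c i j t∈′ in
      (j , k) , e

    ∈T₃ : ∀ a b c {t} → t ∈ T₃ a b c → ∃[ ijk ] t ≡ (a , b , c , ijk)
    ∈T₃ a b c t∈ =
      let i , t∈′ = concatMap⁻ (T₄ a b c) (allFin (μ a b)) t∈ ; jk , e = ∈T₄ a b c i t∈′ in
      (i , jk) , e

    ∈T₂ : ∀ a b {t} → t ∈ T₂ a b → ∃[ t′ ] t ≡ (a , b , t′)
    ∈T₂ a b t∈ =
      let c , t∈′ = concatMap⁻ (T₃ a b) (allFin 4) t∈ ; ijk , e = ∈T₃ a b c t∈′ in
      (c , ijk) , e

    ∈T₁ : ∀ a {t} → t ∈ T₁ a → ∃[ t′ ] t ≡ (a , t′)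
    ∈T₁ a t∈ =
      let b , t∈′ = concatMap⁻ (T₂ a) (allFin 4) t∈ ; t″ , e = ∈T₂ a b t∈′ in
      (b , t″) , e

    T₅-unique : ∀ a b c i j → Unique (T₅ a b c i j)
    T₅-unique a b c i j = Uniqueₚ.map⁺ (λ { refl → refl }) (Uniqueₚ.allFin⁺ _)

    -- Triangles in the block of `j` have fifth coordinate `j`, so different blocks are disjoint.
    -- The same argument recurs at every level.
    T₄-unique : ∀ a b c i → Unique (T₄ a b c i)
    T₄-unique a b c i = concatMap⁺ (T₅ a b c i) (Uniqueₚ.allFin⁺ (μ a c)) (T₅-unique a b c i) inj
      where
      same : ∀ {x y} {t : Triangle μ} →
        (∃[ r ] t ≡ (a , b , c , i , x , r)) → (∃[ r ] t ≡ (a , b , c , i , y , r)) → x ≡ y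
      same (_ , refl) (_ , refl) = refl
      inj : ∀ {x y t} → t ∈ T₅ a b c i x → t ∈ T₅ a b c i y → x ≡ y
      inj {x} {y} p q = same (∈T₅ a b c i x p) (∈T₅ a b c i y q)

    T₃-unique : ∀ a b c → Unique (T₃ a b c)
    T₃-unique a b c = concatMap⁺ (T₄ a b c) (Uniqueₚ.allFin⁺ (μ a b)) (T₄-unique a b c) inj
      where
      same : ∀ {x y} {t : Triangle μ} →
        (∃[ r ] t ≡ (a , b , c , x , r)) → (∃[ r ] t ≡ (a , b , c , y , r)) → x ≡ y
      same (_ , refl) (_ , refl) = refl
      inj : ∀ {x y t} → t ∈ T₄ a b c x → t ∈ T₄ a b c y → x ≡ y
      inj {x} {y} p q = same (∈T₄ a b c x p) (∈T₄ a b c y q)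

    T₂-unique : ∀ a b → Unique (T₂ a b)
    T₂-unique a b = concatMap⁺ (T₃ a b) (Uniqueₚ.allFin⁺ 4) (T₃-unique a b) inj
      where
      same : ∀ {x y} {t : Triangle μ} →
        (∃[ r ] t ≡ (a , b , x , r)) → (∃[ r ] t ≡ (a , b , y , r)) → x ≡ y
      same (_ , refl) (_ , refl) = refl
      inj : ∀ {x y t} → t ∈ T₃ a b x → t ∈ T₃ a b y → x ≡ y
      inj {x} {y} p q = same (∈T₃ a b x p) (∈T₃ a b y q)

    T₁-unique : ∀ a → Unique (T₁ a)
    T₁-unique a = concatMap⁺ (T₂ a) (Uniqueₚ.allFin⁺ 4) (T₂-unique a) inj
      where
      same : ∀ {x y} {t : Triangle μ} →
        (∃[ r ] t ≡ (a , x , r)) → (∃[ r ] t ≡ (a , y , r)) → x ≡ y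
      same (_ , refl) (_ , refl) = refl
      inj : ∀ {x y t} → t ∈ T₂ a x → t ∈ T₂ a y → x ≡ y
      inj {x} {y} p q = same (∈T₂ a x p) (∈T₂ a y q)

  allTriangles-unique : Unique (allTriangles μ)
  allTriangles-unique = concatMap⁺ T₁ (Uniqueₚ.allFin⁺ 4) T₁-unique inj
    where
    same : ∀ {x y} {t : Triangle μ} →
      (∃[ r ] t ≡ (x , r)) → (∃[ r ] t ≡ (y , r)) → x ≡ y
    same (_ , refl) (_ , refl) = refl
    inj : ∀ {x y t} → t ∈ T₁ x → t ∈ T₁ y → x ≡ y
    inj {x} {y} p q = same (∈T₁ x p) (∈T₁ y q)

  ∈-allTriangles : ∀ t → t ∈ allTriangles μ
  ∈-allTriangles (a , b , c , i , j , k) =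
    ∈-concatMap⁺ T₁ (lose (∈-allFin a) (∈-concatMap⁺ (T₂ a) (lose (∈-allFin b)
      (∈-concatMap⁺ (T₃ a b) (lose (∈-allFin c) (∈-concatMap⁺ (T₄ a b c) (lose (∈-allFin i)
        (∈-concatMap⁺ (T₅ a b c i) (lose (∈-allFin j)
          (∈-map⁺ (λ k → a , b , c , i , j , k) (∈-allFin k)))))))))))

-- Double counting of weights along parallel edges.

module _ (μ : Mult) where

  through? : ∀ e t → Dec (IsTriangle μ t × _∈ᵗ_ μ e t)
  through? e t = isTriangle? μ t ×-dec _∈ᵗ?_ μ e t

  ∈-through⁺ : ∀ {e t} → IsTriangle μ t → _∈ᵗ_ μ e t → t ∈ trianglesThrough μ e
  ∈-through⁺ {e} {t} g e∈t = ∈-filter⁺ (through? e) (∈-allTriangles μ t) (g , e∈t)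

  ∈-through⁻ : ∀ {e t} → t ∈ trianglesThrough μ e → IsTriangle μ t × _∈ᵗ_ μ e t
  ∈-through⁻ {e} t∈ = proj₂ (∈-filter⁻ (through? e) {xs = allTriangles μ} t∈)

  through-unique : ∀ e → Unique (trianglesThrough μ e)
  through-unique e = Uniqueₚ.filter⁺ (through? e) (allTriangles-unique μ)

  Avoidsᵗ : Fin 4 → Triangle μ → Set
  Avoidsᵗ d (a , b , c , _) = Avoids d a b c

  avoidsᵗ? : ∀ d t → Dec (Avoidsᵗ d t)
  avoidsᵗ? d (a , b , c , _) = avoids? d a b c

  Sideᵗ : (a b : Fin 4) → Triangle μ → Set
  Sideᵗ a b (x , y , z , _) = Side a b x y z

  ∈ᵗ⇒side : ∀ {a b p} t → _∈ᵗ_ μ (a , b , p) t → Sideᵗ a b t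
  ∈ᵗ⇒side t (inj₁ refl)        = inj₁ (refl , refl)
  ∈ᵗ⇒side t (inj₂ (inj₁ refl)) = inj₂ (inj₁ (refl , refl))
  ∈ᵗ⇒side t (inj₂ (inj₂ refl)) = inj₂ (inj₂ (refl , refl))

  side⇒∈ᵗ : ∀ {a b} t → Sideᵗ a b t → ∃[ p ] _∈ᵗ_ μ (a , b , p) t
  side⇒∈ᵗ (_ , _ , _ , i , j , k) (inj₁ (refl , refl))        = i , inj₁ refl
  side⇒∈ᵗ (_ , _ , _ , i , j , k) (inj₂ (inj₁ (refl , refl))) = j , inj₂ (inj₁ refl)
  side⇒∈ᵗ (_ , _ , _ , i , j , k) (inj₂ (inj₂ (refl , refl))) = k , inj₂ (inj₂ refl)

  -- If the two edges were different sides of `t`, two of its vertices would coincide, against the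
  -- strict order.
  ∈ᵗ-injective : ∀ {a b p q} t → IsTriangle μ t →
    _∈ᵗ_ μ (a , b , p) t → _∈ᵗ_ μ (a , b , q) t → p ≡ q
  ∈ᵗ-injective t (x<y , y<z) (inj₁ refl)        (inj₁ refl)        = refl
  ∈ᵗ-injective t (x<y , y<z) (inj₁ refl)        (inj₂ (inj₁ refl)) = ⊥-elim (Fₚ.<-irrefl refl y<z)
  ∈ᵗ-injective t (x<y , y<z) (inj₁ refl)        (inj₂ (inj₂ refl)) = ⊥-elim (Fₚ.<-irrefl refl y<z)
  ∈ᵗ-injective t (x<y , y<z) (inj₂ (inj₁ refl)) (inj₁ refl)        = ⊥-elim (Fₚ.<-irrefl refl y<z)
  ∈ᵗ-injective t (x<y , y<z) (inj₂ (inj₁ refl)) (inj₂ (inj₁ refl)) = refl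
  ∈ᵗ-injective t (x<y , y<z) (inj₂ (inj₁ refl)) (inj₂ (inj₂ refl)) = ⊥-elim (Fₚ.<-irrefl refl x<y)
  ∈ᵗ-injective t (x<y , y<z) (inj₂ (inj₂ refl)) (inj₁ refl)        = ⊥-elim (Fₚ.<-irrefl refl x<y)
  ∈ᵗ-injective t (x<y , y<z) (inj₂ (inj₂ refl)) (inj₂ (inj₁ refl)) = ⊥-elim (Fₚ.<-irrefl refl x<y)
  ∈ᵗ-injective t (x<y , y<z) (inj₂ (inj₂ refl)) (inj₂ (inj₂ refl)) = refl

  -- The outer bracket is there because `allTriangles` also lists candidates whose vertices are not
  -- increasing.
  omitting : (Triangle μ → ℚ) → Fin 4 → Triangle μ → ℚ
  omitting w d t = [ isTriangle? μ t ] [ avoidsᵗ? d t ] w t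

  -- A triangle contains at most one of the parallel edges ab, so the left side is `w t` or 0,
  -- according to whether ab is a side; `side-or-not` decides this by the missed vertex.
  ∑-parallel : ∀ w {a b c d} → a F.< b → Distinct a b c d → ∀ t →
    ∑ (allFin (μ a b)) (λ p → [ through? (a , b , p) t ] w t) ≡ omitting w c t ℚ.+ omitting w d t
  ∑-parallel w {a} {b} {c} {d} a<b dist t@(x , y , z , _) = by-cases (isTriangle? μ t)
    where
    edges = allFin (μ a b)
    f : Fin (μ a b) → ℚ
    f p = [ through? (a , b , p) t ] w t

    omitting-yes : ∀ {d} → IsTriangle μ t → Avoidsᵗ d t → omitting w d t ≡ w t
    omitting-yes g av = trans ([]-true (isTriangle? μ t) g) ([]-true (avoidsᵗ? _ t) av)

    omitting-no : ∀ {d} → IsTriangle μ t → ¬ Avoidsᵗ d t → omitting w d t ≡ 0ℚ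
    omitting-no g ¬av = trans ([]-true (isTriangle? μ t) g) ([]-false (avoidsᵗ? _ t) ¬av)

    no-side : (∀ p → ¬ (IsTriangle μ t × _∈ᵗ_ μ (a , b , p) t)) → ∑ edges f ≡ 0ℚ
    no-side ¬∈ = ∑-0 edges λ p _ → []-false (through? (a , b , p) t) (¬∈ p)

    one-side : IsTriangle μ t → Sideᵗ a b t → ∑ edges f ≡ w t
    one-side g s = let p , p∈t = side⇒∈ᵗ t s in
      trans (∑-single (Uniqueₚ.allFin⁺ _) (∈-allFin p) λ q _ q≢p →
              []-false (through? (a , b , q) t) λ (_ , q∈t) → q≢p (∈ᵗ-injective t g q∈t p∈t))
            ([]-true (through? (a , b , p) t) (g , p∈t))

    by-cases : Dec (IsTriangle μ t) → ∑ edges f ≡ omitting w c t ℚ.+ omitting w d t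
    by-cases (no ¬g) = trans (no-side λ p (g , _) → ¬g g)
      (sym (cong₂ ℚ._+_ ([]-false (isTriangle? μ t) ¬g) ([]-false (isTriangle? μ t) ¬g)))
    by-cases (yes g) with side-or-not a b a<b x y z g c d dist
    ... | inj₁ (c∉t , d∈t , s) = trans (one-side g s) (sym
      (trans (cong₂ ℚ._+_ (omitting-yes g c∉t) (omitting-no g d∈t)) (ℚₚ.+-identityʳ _)))
    ... | inj₂ (inj₁ (c∈t , d∉t , s)) = trans (one-side g s) (sym
      (trans (cong₂ ℚ._+_ (omitting-no g c∈t) (omitting-yes g d∉t)) (ℚₚ.+-identityˡ _)))
    ... | inj₂ (inj₂ (c∈t , d∈t , ¬s)) = trans (no-side λ p (_ , e∈t) → ¬s (∈ᵗ⇒side t e∈t))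
      (sym (cong₂ ℚ._+_ (omitting-no g c∈t) (omitting-no g d∈t)))

  -- The quantity `X d` of the proof idea.
  omitted : (Triangle μ → ℚ) → Fin 4 → ℚ
  omitted w d = ∑ (allTriangles μ) (omitting w d)

  -- Each of the `μ a b` parallel edges carries total weight 1; exchanging the sums over edges and
  -- triangles leaves the contribution of each triangle, given by `∑-parallel`. Only edges with
  -- `a < b` are genuine, hence the order hypothesis.
  μ-split-< : ∀ w → IsRationalK3Decomposition μ w → ∀ {a b c d} → a F.< b → Distinct a b c d →
    μ a b · 1ℚ ≡ omitted w c ℚ.+ omitted w d
  μ-split-< w (_ , covers) {a} {b} {c} {d} a<b dist = begin
    μ a b · 1ℚ
      ≡⟨ cong (_· 1ℚ) (Listₚ.length-tabulate {n = μ a b} (λ p → p)) ⟨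
    length edges · 1ℚ
      ≡⟨ ∑-const 1ℚ edges ⟨
    ∑ edges (λ _ → 1ℚ)
      ≡⟨ ∑-cong edges (λ p → covers (a , b , p) a<b) ⟨
    ∑ edges (λ p → ∑ (trianglesThrough μ (a , b , p)) w)
      ≡⟨ ∑-cong edges (λ p → ∑-filter (through? (a , b , p)) w (allTriangles μ)) ⟩
    ∑ edges (λ p → ∑ (allTriangles μ) λ t → [ through? (a , b , p) t ] w t)
      ≡⟨ ∑-swap (λ p t → [ through? (a , b , p) t ] w t) edges (allTriangles μ) ⟩
    ∑ (allTriangles μ) (λ t → ∑ edges λ p → [ through? (a , b , p) t ] w t)
      ≡⟨ ∑-cong (allTriangles μ) (∑-parallel w a<b dist) ⟩
    ∑ (allTriangles μ) (λ t → omitting w c t ℚ.+ omitting w d t)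
      ≡⟨ ∑-+ (omitting w c) (omitting w d) (allTriangles μ) ⟩
    omitted w c ℚ.+ omitted w d ∎
    where
    open ≡-Reasoning
    edges = allFin (μ a b)

  omitted-0≤ : ∀ {w} → (∀ t → 0ℚ ℚ.≤ w t) → ∀ d → 0ℚ ℚ.≤ omitted w d
  omitted-0≤ 0≤w d = ∑-0≤ (allTriangles μ) λ t → []-0≤ (isTriangle? μ t) ([]-0≤ (avoidsᵗ? d t) (0≤w t))

-- The multiplicity conditions from the splitting of `μ`.

Splits : Mult → (Fin 4 → ℚ) → Set
Splits μ X = ∀ {a b c d} → Distinct a b c d → μ a b · 1ℚ ≡ X c ℚ.+ X d

-- Multiplicity conditions of part (ii); for n = 2k they amount to those of part (i).
Balanced : Mult → Fin 4 → ℕ → Set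
Balanced μ u n =
  (∀ x y → x ≢ y → x ≢ u → y ≢ u → n ≤ 2 * μ x y) ×
  (∀ x y z → x ≢ y → x ≢ z → y ≢ z → x ≢ u → y ≢ u → z ≢ u → μ u x + n ≡ μ x y + μ x z)

2*-·1 : ∀ n → (2 * n) · 1ℚ ≡ n · 1ℚ ℚ.+ n · 1ℚ
2*-·1 n = trans (×-homo-+ 1ℚ n (n + 0)) (cong (λ k → n · 1ℚ ℚ.+ k · 1ℚ) (ℕₚ.+-identityʳ n))

module _ (μ : Mult) {X : Fin 4 → ℚ} (splits : Splits μ X) where

  -- The two edges at `x` off `u` contribute `X u + X z` and `X u + X y`, while `X y + X z` is the
  -- multiplicity of ux.
  μ-double : ∀ u x y z → Distinct u x y z →
    μ u x · 1ℚ ℚ.+ (X u ℚ.+ X u) ≡ (μ x y + μ x z) · 1ℚ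
  μ-double u x y z (ux , uy , uz , xy , xz , yz) = begin
    μ u x · 1ℚ ℚ.+ (X u ℚ.+ X u)
      ≡⟨ cong (ℚ._+ (X u ℚ.+ X u)) (splits (ux , uy , uz , xy , xz , yz)) ⟩
    (X y ℚ.+ X z) ℚ.+ (X u ℚ.+ X u)
      ≡⟨ ℚₚ.+-comm (X y ℚ.+ X z) (X u ℚ.+ X u) ⟩
    (X u ℚ.+ X u) ℚ.+ (X y ℚ.+ X z)
      ≡⟨ cong ((X u ℚ.+ X u) ℚ.+_) (ℚₚ.+-comm (X y) (X z)) ⟩
    (X u ℚ.+ X u) ℚ.+ (X z ℚ.+ X y)
      ≡⟨ interchange (X u) (X u) (X z) (X y) ⟩
    (X u ℚ.+ X z) ℚ.+ (X u ℚ.+ X y)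
      ≡⟨ cong₂ ℚ._+_ (splits (xy , ≢-sym ux , xz , ≢-sym uy , yz , uz))
                     (splits (xz , ≢-sym ux , xy , ≢-sym uz , ≢-sym yz , uy)) ⟨
    μ x y · 1ℚ ℚ.+ μ x z · 1ℚ
      ≡⟨ ×-homo-+ 1ℚ (μ x y) (μ x z) ⟨
    (μ x y + μ x z) · 1ℚ ∎
    where open ≡-Reasoning

  module _ (0≤X : ∀ d → 0ℚ ℚ.≤ X d) where

    -- Keeping `n` as a given value of `2 X u` lets both parts use this: in the integral case it is
    -- twice a natural number.
    balanced : ∀ u n → n · 1ℚ ≡ X u ℚ.+ X u → Balanced μ u n
    balanced u n n≡2X = bound , equation
      where
      bound : ∀ x y → x ≢ y → x ≢ u → y ≢ u → n ≤ 2 * μ x y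
      -- For the remaining vertex `z`, `μ x y = X u + X z` is at least `X u`.
      bound x y xy xu yu with fourth x y u xy xu yu
      ... | z , dist = ·1-cancel-≤ n (2 * μ x y) (begin
        n · 1ℚ                              ≡⟨ n≡2X ⟩
        X u ℚ.+ X u                         ≤⟨ ℚₚ.+-mono-≤ (p≤p+q (X u) (0≤X z)) (p≤p+q (X u) (0≤X z)) ⟩
        (X u ℚ.+ X z) ℚ.+ (X u ℚ.+ X z)     ≡⟨ cong₂ ℚ._+_ (splits dist) (splits dist) ⟨
        μ x y · 1ℚ ℚ.+ μ x y · 1ℚ           ≡⟨ 2*-·1 (μ x y) ⟨
        (2 * μ x y) · 1ℚ                    ∎)
        where open ℚₚ.≤-Reasoning

      equation : ∀ x y z → x ≢ y → x ≢ z → y ≢ z → x ≢ u → y ≢ u → z ≢ u → μ u x + n ≡ μ x y + μ x z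
      equation x y z xy xz yz xu yu zu = ·1-injective (μ u x + n) (μ x y + μ x z) (begin
        (μ u x + n) · 1ℚ              ≡⟨ ×-homo-+ 1ℚ (μ u x) n ⟩
        μ u x · 1ℚ ℚ.+ n · 1ℚ         ≡⟨ cong (μ u x · 1ℚ ℚ.+_) n≡2X ⟩
        μ u x · 1ℚ ℚ.+ (X u ℚ.+ X u)  ≡⟨ μ-double u x y z
                                           (≢-sym xu , ≢-sym yu , ≢-sym zu , xy , xz , yz) ⟩
        (μ x y + μ x z) · 1ℚ          ∎)
        where open ≡-Reasoning

    -- `2 X u` is nonnegative and, by `μ-double`, a difference of natural numbers, so it is natural
    -- even when `X u` is not.
    balance : ∀ u → ∃[ n ] n · 1ℚ ≡ X u ℚ.+ X u
    balance u with avoiding u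
    ... | x , y , z , (x<y , y<z) , ux , uy , uz =
      ·1-subtract (μ u x) (μ x y + μ x z) (ℚₚ.+-mono-≤ (0≤X u) (0≤X u))
        (μ-double u x y z (ux , uy , uz , Fₚ.<⇒≢ x<y , Fₚ.<⇒≢ (Fₚ.<-trans x<y y<z) , Fₚ.<⇒≢ y<z))

-- Necessity of the conditions.

module _ (μ : Mult) (μ-sym : ∀ x y → μ x y ≡ μ y x) where

  omitted-splits : ∀ {w} → IsRationalK3Decomposition μ w → Splits μ (omitted μ w)
  omitted-splits {w} dec {a} {b} dist@(ab , ac , ad , bc , bd , cd) with Fₚ.<-cmp a b
  ... | tri< a<b _ _ = μ-split-< μ w dec a<b dist
  ... | tri≈ _ a≡b _ = ⊥-elim (ab a≡b)
  ... | tri> _ _ b<a = trans (cong (_· 1ℚ) (μ-sym a b))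
                             (μ-split-< μ w dec b<a (≢-sym ab , bc , bd , ac , ad , cd))

  rational⇒balanced : ∀ u → RationallyK3Decomposable μ → ∃[ n ] Balanced μ u n
  rational⇒balanced u (w , dec@(0≤w , _)) =
    let n , e = balance μ (omitted-splits dec) (omitted-0≤ μ 0≤w) u in
    n , balanced μ (omitted-splits dec) (omitted-0≤ μ 0≤w) u n e

  -- The indicator function of the chosen triangles is a rational decomposition with values 0 and 1,
  -- so `X u` is itself a natural number.
  decomposable⇒balanced : ∀ u → K3Decomposable μ → ∃[ n ] Balanced μ u (2 * n)
  decomposable⇒balanced u (S , S⊆ , exactly-one) =
    let n , e = ∑-natural (allTriangles μ) omitting-natural in
    n , balanced μ (omitted-splits dec) (omitted-0≤ μ 0≤w) u (2 * n)
                 (trans (2*-·1 n) (cong₂ ℚ._+_ e e))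
    where
    w : Triangle μ → ℚ
    w t = [ S t Boolₚ.≟ true ] 1ℚ

    []-natural : {P : Set} (P? : Dec P) {q : ℚ} → Natural q → Natural ([ P? ] q)
    []-natural P? nat with does P?
    ... | true  = nat
    ... | false = 0 , refl

    omitting-natural : ∀ t → Natural (omitting μ w u t)
    omitting-natural t = []-natural (isTriangle? μ t) ([]-natural (avoidsᵗ? μ u t)
      ([]-natural (S t Boolₚ.≟ true) (1 , refl)))

    0≤w : ∀ t → 0ℚ ℚ.≤ w t
    0≤w t = []-0≤ (S t Boolₚ.≟ true) (0≤n·1 1)

    covers : ∀ e → IsEdge μ e → ∑ (trianglesThrough μ e) w ≡ 1ℚ
    covers e g with exactly-one e g
    ... | t , (St , e∈t) , unique = trans
      (∑-single (through-unique μ e) (∈-through⁺ μ (S⊆ t St) e∈t) λ t′ t′∈ t′≢t →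
        []-false (S t′ Boolₚ.≟ true) λ St′ → t′≢t (sym (unique (St′ , proj₂ (∈-through⁻ μ t′∈)))))
      ([]-true (S t Boolₚ.≟ true) St)

    dec : IsRationalK3Decomposition μ w
    dec = 0≤w , covers

-- Colouring the parallel edges.

does⇒ : {P : Set} (P? : Dec P) → does P? ≡ true → P
does⇒ (yes p) _ = p

module _ {A : Set} (n : ℕ) (f g : ℕ → A) where

  -- Concatenation: the first `n` terms of `f` followed by the sequence `g`.
  layer : ℕ → A
  layer s = if does (s ℕ.<? n) then f s else g (s ∸ n)

  layer-low : ∀ {s} → s ℕ.< n → layer s ≡ f s
  layer-low {s} s<n rewrite dec-true (s ℕ.<? n) s<n = refl

  layer-high : ∀ r → layer (n + r) ≡ g r
  layer-high r rewrite dec-false (n + r ℕ.<? n) (ℕₚ.m+n≮m n r) = cong g (ℕₚ.m+n∸m≡n n r)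

  layer-view : ∀ s → (s ℕ.< n × layer s ≡ f s) ⊎ ∃[ r ] (s ≡ n + r × layer s ≡ g r)
  layer-view s with s ℕ.<? n
  ... | yes s<n = inj₁ (s<n , layer-low s<n)
  ... | no  s≮n = inj₂ (s ∸ n , s≡ , trans (cong layer s≡) (layer-high (s ∸ n)))
    where
    s≡ : s ≡ n + (s ∸ n)
    s≡ = sym (ℕₚ.m+[n∸m]≡n (ℕₚ.≮⇒≥ s≮n))

  layer-injective : (∀ {r s} → f r ≡ f s → r ≡ s) → (∀ {r s} → g r ≡ g s → r ≡ s) →
    (∀ {r s} → f r ≢ g s) → ∀ {r s} → layer r ≡ layer s → r ≡ s
  layer-injective f-inj g-inj f≢g {r} {s} e with layer-view r | layer-view s
  ... | inj₁ (_ , p)        | inj₁ (_ , q)        = f-inj (trans (sym p) (trans e q))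
  ... | inj₁ (_ , p)        | inj₂ (_ , _ , q)    = ⊥-elim (f≢g (trans (sym p) (trans e q)))
  ... | inj₂ (_ , _ , p)    | inj₁ (_ , q)        = ⊥-elim (f≢g (trans (sym q) (trans (sym e) p)))
  ... | inj₂ (_ , refl , p) | inj₂ (_ , refl , q) = cong (n +_) (g-inj (trans (sym p) (trans e q)))

-- A rational decomposition is built from monochromatic triangles: the colour full d q belongs to
-- a single triangle of weight 1 avoiding the vertex d, the colour half r to four triangles of
-- weight ½, one avoiding each vertex.
Colour : Set
Colour = (Fin 4 × ℕ) ⊎ ℕ

pattern full d q = inj₁ (d , q)
pattern half r   = inj₂ r

_≟ᶜ_ : (κ κ′ : Colour) → Dec (κ ≡ κ′)
_≟ᶜ_ = Sumₚ.≡-dec (Productₚ.≡-dec _≟_ ℕ._≟_) ℕ._≟_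

weightOf : Colour → ℚ
weightOf (full d q) = 1ℚ
weightOf (half r)   = ½

module _ (μ : Mult) (m : Fin 4 → ℕ) (ε : ℕ)
         (splits : ∀ {a b c d} → Distinct a b c d → μ a b ≡ m c + (m d + ε)) where

  -- The colours allowed on an edge ab: a full triangle uses such an edge only if it avoids neither
  -- endpoint. For distinct endpoints there are `m c + m d + ε = μ a b` of them, so each can be
  -- given to exactly one parallel edge.
  Valid : Fin 4 → Fin 4 → Colour → Set
  Valid a b (full d q) = d ≢ a × d ≢ b × q ℕ.< m d
  Valid a b (half r)   = r ℕ.< ε

  private
    full′ : Fin 4 → ℕ → Colour
    full′ d q = full d q

    half′ : ℕ → Colour
    half′ r = half r

  opaque

    inner : Fin 4 → ℕ → Colour
    inner d = layer (m d) (full′ d) half′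

    outer : Fin 4 → Fin 4 → ℕ → Colour
    outer c d = layer (m c) (full′ c) (inner d)

    -- With `c` and `d` the other two vertices, the parallel edges receive `m c` full colours for
    -- `c`, then `m d` for `d`, then the half colours. Later arguments use only validity,
    -- surjectivity and injectivity of this assignment.
    edgeColour : Fin 4 → Fin 4 → ℕ → Colour
    edgeColour a b = outer (proj₁ (complement a b)) (proj₂ (complement a b))

    edgeColour-valid : ∀ {a b} → a ≢ b → ∀ s → s ℕ.< μ a b → Valid a b (edgeColour a b s)
    edgeColour-valid {a} {b} a≢b s s<μ with complement a b | complement-distinct a b a≢b
    ... | c , d | dist@(ab , ac , ad , bc , bd , cd)
      with layer-view (m c) (full′ c) (inner d) s
    ... | inj₁ (s<mc , e) = subst (Valid a b) (sym e) (≢-sym ac , ≢-sym bc , s<mc)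
    ... | inj₂ (r , refl , e) with layer-view (m d) (full′ d) half′ r
    ... | inj₁ (r<md , e′) = subst (Valid a b) (sym (trans e e′)) (≢-sym ad , ≢-sym bd , r<md)
    -- Here the index is `m c + (m d + r′)`; cancelling in `s < μ a b` leaves `r′ < ε`.
    ... | inj₂ (r′ , refl , e′) = subst (Valid a b) (sym (trans e e′))
      (ℕₚ.+-cancelˡ-< (m d) r′ ε (ℕₚ.+-cancelˡ-< (m c) _ _ (subst (_ ℕ.<_) (splits dist) s<μ)))

    edgeColour-surjective : ∀ {a b} → a ≢ b → ∀ κ → Valid a b κ →
      ∃[ s ] (s ℕ.< μ a b × edgeColour a b s ≡ κ)
    edgeColour-surjective {a} {b} a≢b κ v with complement a b | complement-distinct a b a≢b
    ... | c , d | dist with κ | v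
    ... | half r | r<ε = m c + (m d + r)
          , subst (_ ℕ.<_) (sym (splits dist)) (ℕₚ.+-monoʳ-< (m c) (ℕₚ.+-monoʳ-< (m d) r<ε))
          , trans (layer-high (m c) (full′ c) (inner d) (m d + r)) (layer-high (m d) (full′ d) half′ r)
    ... | full x q | x≢a , x≢b , q<mx with exhaust a b c d dist x
    ... | inj₁ x≡a = ⊥-elim (x≢a x≡a)
    ... | inj₂ (inj₁ x≡b) = ⊥-elim (x≢b x≡b)
    ... | inj₂ (inj₂ (inj₁ refl)) = q
          , subst (q ℕ.<_) (sym (splits dist)) (ℕₚ.m≤n⇒m≤n+o _ q<mx)
          , layer-low (m c) (full′ c) (inner d) q<mx
    ... | inj₂ (inj₂ (inj₂ refl)) = m c + q
          , subst (_ ℕ.<_) (sym (splits dist)) (ℕₚ.+-monoʳ-< (m c) (ℕₚ.m≤n⇒m≤n+o _ q<mx))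
          , trans (layer-high (m c) (full′ c) (inner d) q) (layer-low (m d) (full′ d) half′ q<mx)

    -- The three layers share no colour: the full ones differ because `c ≢ d`, and half colours are
    -- never full.
    edgeColour-injective : ∀ {a b} → a ≢ b → ∀ {r s} → edgeColour a b r ≡ edgeColour a b s → r ≡ s
    edgeColour-injective {a} {b} a≢b with complement a b | complement-distinct a b a≢b
    ... | c , d | _ , _ , _ , _ , _ , c≢d = layer-injective (m c) (full′ c) (inner d) (λ { refl → refl })
      (layer-injective (m d) (full′ d) half′ (λ { refl → refl }) (λ { refl → refl }) λ ())
      full≢
      where
      full≢ : ∀ {r s} → full c r ≢ inner d s
      full≢ {r} {s} e with layer-view (m d) (full′ d) half′ s
      ... | inj₁ (_ , p)     = c≢d (cong proj₁ (Sumₚ.inj₁-injective (trans e p)))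
      ... | inj₂ (_ , _ , p) with () ← trans e p

  colour : Edge μ → Colour
  colour (a , b , p) = edgeColour a b (toℕ p)

  colour-valid : ∀ {a b} → a ≢ b → ∀ p → Valid a b (colour (a , b , p))
  colour-valid a≢b p = edgeColour-valid a≢b (toℕ p) (Fₚ.toℕ<n p)

  colour-surjective : ∀ {a b} → a ≢ b → ∀ κ → Valid a b κ → ∃[ p ] colour (a , b , p) ≡ κ
  colour-surjective {a} {b} a≢b κ v = let s , s<μ , e = edgeColour-surjective a≢b κ v in
    fromℕ< s<μ , trans (cong (edgeColour a b) (Fₚ.toℕ-fromℕ< s<μ)) e

  colour-injective : ∀ {a b} → a ≢ b → ∀ {p q κ} →
    colour (a , b , p) ≡ κ → colour (a , b , q) ≡ κ → p ≡ q
  colour-injective a≢b e e′ = Fₚ.toℕ-injective (edgeColour-injective a≢b (trans e (sym e′)))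

  -- Monochromatic triangles and their weights.

  Mono : Colour → Triangle μ → Set
  Mono κ t = colour (edgeAB μ t) ≡ κ × colour (edgeAC μ t) ≡ κ × colour (edgeBC μ t) ≡ κ

  mono? : ∀ κ t → Dec (Mono κ t)
  mono? κ t = colour (edgeAB μ t) ≟ᶜ κ ×-dec colour (edgeAC μ t) ≟ᶜ κ ×-dec colour (edgeBC μ t) ≟ᶜ κ

  mono-colour : ∀ {κ e} t → Mono κ t → _∈ᵗ_ μ e t → colour e ≡ κ
  mono-colour t (p , q , r) (inj₁ refl)        = p
  mono-colour t (p , q , r) (inj₂ (inj₁ refl)) = q
  mono-colour t (p , q , r) (inj₂ (inj₂ refl)) = r

  sorted⇒≢ : ∀ {a b c} → Sorted a b c → a ≢ b × a ≢ c × b ≢ c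
  sorted⇒≢ (a<b , b<c) = Fₚ.<⇒≢ a<b , Fₚ.<⇒≢ (Fₚ.<-trans a<b b<c) , Fₚ.<⇒≢ b<c

  -- The missed vertex fixes the three vertices, and `κ` then selects one parallel edge on each
  -- side.
  mono-unique : ∀ {κ d} t t′ → IsTriangle μ t → IsTriangle μ t′ →
    Avoidsᵗ μ d t → Avoidsᵗ μ d t′ → Mono κ t → Mono κ t′ → t ≡ t′
  mono-unique {d = d} (a , b , c , _) (x , y , z , _) g g′ av av′ (p , q , r) (p′ , q′ , r′)
    with sorted-unique a b c g x y z g′ d av av′ | sorted⇒≢ g
  ... | refl , refl , refl | ab , ac , bc
    with colour-injective ab p p′ | colour-injective ac q q′ | colour-injective bc r r′
  ... | refl | refl | refl = refl

  mono-exists : ∀ κ d → (∀ {a b} → d ≢ a → d ≢ b → Valid a b κ) →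
    ∃[ t ] (IsTriangle μ t × Avoidsᵗ μ d t × Mono κ t)
  mono-exists κ d v with avoiding d
  ... | a , b , c , g , av@(da , db , dc) =
    let ab , ac , bc = sorted⇒≢ g
        i , p = colour-surjective ab κ (v da db)
        j , q = colour-surjective ac κ (v da dc)
        k , r = colour-surjective bc κ (v db dc)
    in (a , b , c , i , j , k) , g , av , p , q , r

  -- The side xy of `t` has colour `κ`, which only one of the parallel edges xy carries.
  mono-∋ : ∀ {κ d x y p} t → IsTriangle μ t → Avoidsᵗ μ d t → Mono κ t →
    x F.< y → d ≢ x → d ≢ y → colour (x , y , p) ≡ κ → _∈ᵗ_ μ (x , y , p) t
  mono-∋ {κ} {d} {x} {y} {p} t@(a , b , c , _) g av mono x<y dx dy e
    with side⇒∈ᵗ μ t (avoiding-side a b c g x y x<y d av dx dy)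
  ... | q , q∈t = subst (λ p → _∈ᵗ_ μ (x , y , p) t)
    (colour-injective (Fₚ.<⇒≢ x<y) (mono-colour t mono q∈t) e) q∈t

  mono-full⇒avoids : ∀ {d q} t → IsTriangle μ t → Mono (full d q) t → Avoidsᵗ μ d t
  mono-full⇒avoids (a , b , c , i , j , k) g (p , q , r) =
    let ab , ac , bc = sorted⇒≢ g
        da , db , _ = subst (Valid a b) p (colour-valid ab i)
        _ , dc , _  = subst (Valid b c) r (colour-valid bc k)
    in da , db , dc

  ownColour : Triangle μ → Colour
  ownColour t = colour (edgeAB μ t)

  -- The order of the vertices is not tested here, since `trianglesThrough` filters for it.
  monoWeight : Triangle μ → ℚ
  monoWeight t = [ mono? (ownColour t) t ] weightOf (ownColour t)

  monoWeight-mono : ∀ {κ} t → Mono κ t → monoWeight t ≡ weightOf κ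
  monoWeight-mono t mono@(refl , _) = []-true (mono? (ownColour t) t) mono

  monoWeight-other : ∀ {e} t → _∈ᵗ_ μ e t → ¬ Mono (colour e) t → monoWeight t ≡ 0ℚ
  monoWeight-other t e∈t ¬mono = []-false (mono? (ownColour t) t) λ mono →
    ¬mono (subst (λ κ → Mono κ t) (sym (mono-colour t mono e∈t)) mono)

  weightOf-0≤ : ∀ κ → 0ℚ ℚ.≤ weightOf κ
  weightOf-0≤ (full _ _) = 0≤n·1 1
  weightOf-0≤ (half _)   = toWitness {a? = 0ℚ ℚₚ.≤? ½} _

  monoWeight-values : ∀ t → monoWeight t ≡ 0ℚ ⊎ monoWeight t ≡ 1ℚ ⊎ monoWeight t ≡ ½
  monoWeight-values t with does (mono? (ownColour t) t)
  ... | false = inj₁ refl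
  ... | true with ownColour t
  ...   | full _ _ = inj₂ (inj₁ refl)
  ...   | half _   = inj₂ (inj₂ refl)

  -- Validity puts `d` off the edge, so the triangle avoiding `d` in this colour exists and contains
  -- it. Any competitor of the same colour must avoid `d` too.
  full-unique : ∀ {x y p d q} → x F.< y → colour (x , y , p) ≡ full d q →
    ∃! _≡_ (λ t → (IsTriangle μ t × Mono (full d q) t) × _∈ᵗ_ μ (x , y , p) t)
  full-unique {x} {y} {p} {d} {q} x<y e with subst (Valid x y) e (colour-valid (Fₚ.<⇒≢ x<y) p)
  ... | dx , dy , q<m with mono-exists (full d q) d (λ da db → da , db , q<m)
  ... | t , g , av , mono = t , ((g , mono) , mono-∋ t g av mono x<y dx dy e) ,
    λ {t′} ((g′ , mono′) , _) → mono-unique t t′ g g′ av (mono-full⇒avoids t′ g′ mono′) mono mono′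

  covers-by-colour : ∀ {x y p} → x F.< y → ∀ κ → colour (x , y , p) ≡ κ →
    ∑ (trianglesThrough μ (x , y , p)) monoWeight ≡ 1ℚ
  covers-by-colour {x} {y} {p} x<y (full d q) e with full-unique x<y e
  ... | t , ((g , mono) , e∈t) , unique = trans
    (∑-single (through-unique μ (x , y , p)) (∈-through⁺ μ g e∈t) others) (monoWeight-mono t mono)
    where
    others : ∀ t′ → t′ ∈ trianglesThrough μ (x , y , p) → t′ ≢ t → monoWeight t′ ≡ 0ℚ
    others t′ t′∈ t′≢t = let g′ , e∈t′ = ∈-through⁻ μ t′∈ in
      monoWeight-other t′ e∈t′ λ mono′ →
        t′≢t (sym (unique ((g′ , subst (λ κ → Mono κ t′) e mono′) , e∈t′)))
  covers-by-colour {x} {y} {p} x<y (half r) e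
    with complement x y | complement-distinct x y (Fₚ.<⇒≢ x<y)
  ... | c , d | dist@(xy , xc , xd , yc , yd , cd)
    -- Validity of a half colour is just `r < ε`, whatever the edge, so it carries over from xy to
    -- all sides of both triangles.
    with mono-exists (half r) c (λ _ _ → subst (Valid x y) e (colour-valid xy p))
       | mono-exists (half r) d (λ _ _ → subst (Valid x y) e (colour-valid xy p))
  ... | t₁ , g₁ , av₁ , mono₁ | t₂ , g₂ , av₂ , mono₂ = trans
    (∑-double (through-unique μ (x , y , p)) (∈-through⁺ μ g₁ e∈t₁) (∈-through⁺ μ g₂ e∈t₂) t₁≢t₂ others)
    (cong₂ ℚ._+_ (monoWeight-mono t₁ mono₁) (monoWeight-mono t₂ mono₂))
    where
    e∈t₁ = mono-∋ t₁ g₁ av₁ mono₁ x<y (≢-sym xc) (≢-sym yc) e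
    e∈t₂ = mono-∋ t₂ g₂ av₂ mono₂ x<y (≢-sym xd) (≢-sym yd) e

    t₁≢t₂ : t₁ ≢ t₂
    t₁≢t₂ t₁≡t₂ = cd (avoids-unique _ _ _ g₁ c d av₁ (subst (Avoidsᵗ μ d) (sym t₁≡t₂) av₂))

    -- The vertex missed by a triangle through xy is neither `x` nor `y`, hence `c` or `d`.
    one-of-two : ∀ t → IsTriangle μ t → _∈ᵗ_ μ (x , y , p) t → Mono (half r) t → t ≡ t₁ ⊎ t ≡ t₂
    one-of-two t@(a , b , c′ , _) g e∈t mono with avoided a b c′ g
    ... | d′ , av with exhaust x y c d dist d′ | side-avoids (∈ᵗ⇒side μ t e∈t) av
    ... | inj₁ d′≡x               | d′≢x , _ = ⊥-elim (d′≢x d′≡x)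
    ... | inj₂ (inj₁ d′≡y)        | _ , d′≢y = ⊥-elim (d′≢y d′≡y)
    ... | inj₂ (inj₂ (inj₁ refl)) | _ = inj₁ (mono-unique t t₁ g g₁ av av₁ mono mono₁)
    ... | inj₂ (inj₂ (inj₂ refl)) | _ = inj₂ (mono-unique t t₂ g g₂ av av₂ mono mono₂)

    others : ∀ t → t ∈ trianglesThrough μ (x , y , p) → t ≢ t₁ → t ≢ t₂ → monoWeight t ≡ 0ℚ
    others t t∈ ≢₁ ≢₂ = let g , e∈t = ∈-through⁻ μ t∈ in
      monoWeight-other t e∈t λ mono →
        Sum.[ ≢₁ , ≢₂ ] (one-of-two t g e∈t (subst (λ κ → Mono κ t) e mono))

  monoWeight-decomposition : IsRationalK3Decomposition μ monoWeight
  monoWeight-decomposition =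
    (λ t → []-0≤ (mono? (ownColour t) t) (weightOf-0≤ (ownColour t))) ,
    λ (x , y , p) x<y → covers-by-colour x<y (colour (x , y , p)) refl

  -- Without half colours, each edge lies in exactly one genuine monochromatic triangle.
  monoDecomposition : ε ≡ 0 → K3Decomposable μ
  monoDecomposition refl = does ∘ chosen? , (λ t St → proj₁ (does⇒ (chosen? t) St)) , exactly-one
    where
    chosen? : ∀ t → Dec (IsTriangle μ t × Mono (ownColour t) t)
    chosen? t = isTriangle? μ t ×-dec mono? (ownColour t) t

    by-colour : ∀ {x y p} → x F.< y → ∀ κ → colour (x , y , p) ≡ κ →
      ∃! _≡_ (λ t → does (chosen? t) ≡ true × _∈ᵗ_ μ (x , y , p) t)
    -- Validity would give `r < 0`.
    by-colour {x} {y} {p} x<y (half r) e with () ← subst (Valid x y) e (colour-valid (Fₚ.<⇒≢ x<y) p)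
    by-colour {x} {y} {p} x<y (full d q) e with full-unique x<y e
    ... | t , ((g , mono@(p₁ , _)) , e∈t) , unique =
      t , (dec-true (chosen? t) (g , subst (λ κ → Mono κ t) (sym p₁) mono) , e∈t) ,
      λ {t′} (St′ , e∈t′) → let g′ , mono′ = does⇒ (chosen? t′) St′ in
        unique ((g′ , subst (λ κ → Mono κ t′) (trans (sym (mono-colour t′ mono′ e∈t′)) e) mono′) , e∈t′)

    exactly-one : ∀ e → IsEdge μ e → ∃! _≡_ (λ t → does (chosen? t) ≡ true × _∈ᵗ_ μ e t)
    exactly-one (x , y , p) x<y = by-colour x<y (colour (x , y , p)) refl

-- Numbers of full triangles, with `n′ = 2h + ε`.

module _ (μ : Mult) (μ-sym : ∀ x y → μ x y ≡ μ y x) (u : Fin 4) (h ε : ℕ)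
         (bound : ∀ x y → x ≢ y → x ≢ u → y ≢ u → h + ε ≤ μ x y)
         (equation : ∀ x y z → x ≢ y → x ≢ z → y ≢ z → x ≢ u → y ≢ u → z ≢ u →
           μ u x + (2 * h + ε) ≡ μ x y + μ x z) where

  -- The number of triangles of weight 1 that avoid d.
  fullCount : Fin 4 → ℕ
  fullCount d with d ≟ u
  ... | yes _ = h
  ... | no  _ = μ (proj₁ (complement u d)) (proj₂ (complement u d)) ∸ (h + ε)

  fullCount-u : fullCount u ≡ h
  fullCount-u with u ≟ u
  ... | yes _  = refl
  ... | no u≢u = ⊥-elim (u≢u refl)

  μ-complement : ∀ {d x y} → Distinct u d x y →
    μ (proj₁ (complement u d)) (proj₂ (complement u d)) ≡ μ x y
  μ-complement {d} {x} {y} dist@(ud , _)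
    with complement u d | complement-distinct u d ud
  ... | c , c′ | _ , uc , uc′ , dc , dc′ , cc′ with exhaust u d x y dist c | exhaust u d x y dist c′
  ... | inj₁ c≡u                | _                        = ⊥-elim (uc (sym c≡u))
  ... | inj₂ (inj₁ c≡d)         | _                        = ⊥-elim (dc (sym c≡d))
  ... | inj₂ (inj₂ _)           | inj₁ c′≡u                = ⊥-elim (uc′ (sym c′≡u))
  ... | inj₂ (inj₂ _)           | inj₂ (inj₁ c′≡d)         = ⊥-elim (dc′ (sym c′≡d))
  ... | inj₂ (inj₂ (inj₁ refl)) | inj₂ (inj₂ (inj₁ refl)) = ⊥-elim (cc′ refl)
  ... | inj₂ (inj₂ (inj₁ refl)) | inj₂ (inj₂ (inj₂ refl)) = refl
  ... | inj₂ (inj₂ (inj₂ refl)) | inj₂ (inj₂ (inj₁ refl)) = μ-sym c c′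
  ... | inj₂ (inj₂ (inj₂ refl)) | inj₂ (inj₂ (inj₂ refl)) = ⊥-elim (cc′ refl)

  -- `bound` makes the truncated subtraction in `fullCount` exact.
  fullCount-other : ∀ {d x y} → Distinct u d x y → μ x y ≡ fullCount d + (h + ε)
  fullCount-other {d} {x} {y} dist@(ud , ux , uy , _ , _ , xy) with d ≟ u
  ... | yes d≡u = ⊥-elim (ud (sym d≡u))
  ... | no _    = begin
    μ x y                             ≡⟨ ℕₚ.m∸n+n≡m (bound x y xy (≢-sym ux) (≢-sym uy)) ⟨
    μ x y ∸ (h + ε) + (h + ε)         ≡⟨ cong (λ k → k ∸ (h + ε) + (h + ε)) (μ-complement dist) ⟨
    μ (proj₁ (complement u d)) (proj₂ (complement u d)) ∸ (h + ε) + (h + ε) ∎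
    where open ≡-Reasoning

  -- After adding `2h + ε`, `equation` replaces the left side by `μ b c + μ b d`, and
  -- `fullCount-other` rewrites both summands.
  μ-at-u : ∀ {b c d} → Distinct u b c d → μ u b ≡ fullCount c + (fullCount d + ε)
  μ-at-u {b} {c} {d} (ub , uc , ud , bc , bd , cd) = ℕₚ.+-cancelʳ-≡ (2 * h + ε) _ _ (begin
    μ u b + (2 * h + ε)
      ≡⟨ equation b c d bc bd cd (≢-sym ub) (≢-sym uc) (≢-sym ud) ⟩
    μ b c + μ b d
      ≡⟨ cong₂ _+_ (fullCount-other (ud , ub , uc , ≢-sym bd , ≢-sym cd , bc))
                   (fullCount-other (uc , ub , ud , ≢-sym bc , cd , bd)) ⟩
    (fullCount d + (h + ε)) + (fullCount c + (h + ε))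
      ≡⟨ rearrange (fullCount c) (fullCount d) h ε ⟩
    fullCount c + (fullCount d + ε) + (2 * h + ε) ∎)
    where
    open ≡-Reasoning
    rearrange : ∀ c d h ε → (d + (h + ε)) + (c + (h + ε)) ≡ c + (d + ε) + (2 * h + ε)
    rearrange = solve-∀

  -- The cases are whether `u` is an endpoint of ab or one of the two opposite vertices; in the
  -- latter, `h` is the count at `u`.
  fullCount-splits : ∀ {a b c d} → Distinct a b c d → μ a b ≡ fullCount c + (fullCount d + ε)
  fullCount-splits {a} {b} {c} {d} dist@(ab , ac , ad , bc , bd , cd) with exhaust a b c d dist u
  ... | inj₁ refl               = μ-at-u dist
  ... | inj₂ (inj₁ refl)        = trans (μ-sym a b) (μ-at-u (≢-sym ab , bc , bd , ac , ad , cd))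
  ... | inj₂ (inj₂ (inj₁ refl)) = begin
    μ a b                             ≡⟨ fullCount-other (rotate dist) ⟩
    fullCount d + (h + ε)             ≡⟨ x∙yz≈y∙xz (fullCount d) h ε ⟩
    h + (fullCount d + ε)             ≡⟨ cong (_+ (fullCount d + ε)) fullCount-u ⟨
    fullCount c + (fullCount d + ε)   ∎
    where open ≡-Reasoning
  ... | inj₂ (inj₂ (inj₂ refl)) = begin
    μ a b                             ≡⟨ fullCount-other
                                           (≢-sym cd , ≢-sym ad , ≢-sym bd , ≢-sym ac , ≢-sym bc , ab) ⟩
    fullCount c + (h + ε)             ≡⟨ cong (λ k → fullCount c + (k + ε)) fullCount-u ⟨
    fullCount c + (fullCount d + ε)   ∎
    where open ≡-Reasoning

-- The bound `n′/2 ≤ k` rounds up because `k` is an integer: `k < h + ε` would give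
-- `2k + 2 ≤ 2h + 2ε ≤ 2k + ε`, so `2 ≤ ε`.
halve-bound : ∀ {h ε k} → ε ℕ.< 2 → 2 * h + ε ≤ 2 * k → h + ε ≤ k
halve-bound {h} {ε} {k} ε<2 2h+ε≤2k = ℕₚ.≮⇒≥ λ k<h+ε → ℕₚ.<⇒≱ ε<2 (ℕₚ.+-cancelˡ-≤ (2 * k) 2 ε (begin
  2 * k + 2         ≡⟨ ℕₚ.+-comm (2 * k) 2 ⟩
  2 + 2 * k         ≡⟨ ℕₚ.*-suc 2 k ⟨
  2 * suc k         ≤⟨ ℕₚ.*-monoʳ-≤ 2 k<h+ε ⟩
  2 * (h + ε)       ≡⟨ regroup h ε ⟩
  2 * h + ε + ε     ≤⟨ ℕₚ.+-monoˡ-≤ ε 2h+ε≤2k ⟩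
  2 * k + ε         ∎))
  where
  open ℕₚ.≤-Reasoning
  regroup : ∀ h ε → 2 * (h + ε) ≡ 2 * h + ε + ε
  regroup = solve-∀

-- Sufficiency of the conditions.

module _ (μ : Mult) (μ-sym : ∀ x y → μ x y ≡ μ y x) (u : Fin 4) where

  balanced⇒half-integral : ∃[ n ] Balanced μ u n →
    Σ[ w ∈ (Triangle μ → ℚ) ] (IsRationalK3Decomposition μ w × (∀ t → w t ≡ 0ℚ ⊎ w t ≡ 1ℚ ⊎ w t ≡ ½))
  balanced⇒half-integral (n , bound , equation) =
    monoWeight μ m ε m-splits ,
    monoWeight-decomposition μ m ε m-splits ,
    monoWeight-values μ m ε m-splits
    where
    h = n / 2
    ε = n % 2

    n≡ : n ≡ 2 * h + ε
    n≡ = trans (m≡m%n+[m/n]*n n 2) (trans (ℕₚ.+-comm ε (h * 2)) (cong (_+ ε) (ℕₚ.*-comm h 2)))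

    bound′ : ∀ x y → x ≢ y → x ≢ u → y ≢ u → h + ε ≤ μ x y
    bound′ x y xy xu yu = halve-bound {h} (m%n<n n 2) (subst (_≤ 2 * μ x y) n≡ (bound x y xy xu yu))

    equation′ : ∀ x y z → x ≢ y → x ≢ z → y ≢ z → x ≢ u → y ≢ u → z ≢ u →
      μ u x + (2 * h + ε) ≡ μ x y + μ x z
    equation′ x y z xy xz yz xu yu zu =
      trans (cong (μ u x +_) (sym n≡)) (equation x y z xy xz yz xu yu zu)

    m = fullCount μ μ-sym u h ε bound′ equation′
    m-splits : ∀ {a b c d} → Distinct a b c d → μ a b ≡ m c + (m d + ε)
    m-splits = fullCount-splits μ μ-sym u h ε bound′ equation′

  -- Taking `h = n` and `ε = 0` leaves only triangles of weight 1.
  balanced⇒decomposable : ∃[ n ] Balanced μ u (2 * n) → K3Decomposable μ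
  balanced⇒decomposable (n , bound , equation) =
    monoDecomposition μ (fullCount μ μ-sym u n 0 bound′ equation′) 0
      (fullCount-splits μ μ-sym u n 0 bound′ equation′) refl
    where
    bound′ : ∀ x y → x ≢ y → x ≢ u → y ≢ u → n + 0 ≤ μ x y
    bound′ x y xy xu yu = subst (_≤ μ x y) (sym (ℕₚ.+-identityʳ n))
      (ℕₚ.*-cancelˡ-≤ 2 (bound x y xy xu yu))

    equation′ : ∀ x y z → x ≢ y → x ≢ z → y ≢ z → x ≢ u → y ≢ u → z ≢ u →
      μ u x + (2 * n + 0) ≡ μ x y + μ x z
    equation′ x y z xy xz yz xu yu zu =
      trans (cong (μ u x +_) (ℕₚ.+-identityʳ (2 * n))) (equation x y z xy xz yz xu yu zu)

theorem10 : (μ : Mult) →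
    (∀ x y → μ x y ≡ μ y x) →
    (∀ x y → x ≢ y → 1 ≤ μ x y) →
    (u : Fin 4) →
    (K3Decomposable μ ⇔
      (∃[ n ] ((∀ x y → x ≢ y → x ≢ u → y ≢ u → n ≤ μ x y) ×
               (∀ x y z → x ≢ y → x ≢ z → y ≢ z → x ≢ u → y ≢ u → z ≢ u →
                  μ u x + 2 * n ≡ μ x y + μ x z))))
    ×
    (RationallyK3Decomposable μ ⇔
      (∃[ n′ ] ((∀ x y → x ≢ y → x ≢ u → y ≢ u → n′ ≤ 2 * μ x y) ×
                (∀ x y z → x ≢ y → x ≢ z → y ≢ z → x ≢ u → y ≢ u → z ≢ u →
                   μ u x + n′ ≡ μ x y + μ x z))))
    ×
    (RationallyK3Decomposable μ →
      Σ[ w ∈ (Triangle μ → ℚ) ] (IsRationalK3Decomposition μ w ×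
        (∀ t → w t ≡ 0ℚ ⊎ w t ≡ 1ℚ ⊎ w t ≡ ½)))
theorem10 μ μ-sym _ u =
  mk⇔ (λ dec → let n , bound , equation = decomposable⇒balanced μ μ-sym u dec in
         n , (λ x y xy xu yu → ℕₚ.*-cancelˡ-≤ 2 (bound x y xy xu yu)) , equation)
      (λ (n , bound , equation) → balanced⇒decomposable μ μ-sym u
         (n , (λ x y xy xu yu → ℕₚ.*-monoʳ-≤ 2 (bound x y xy xu yu)) , equation)) ,
  mk⇔ (rational⇒balanced μ μ-sym u)
      (λ bal → let w , dec , _ = balanced⇒half-integral μ μ-sym u bal in w , dec) ,
  -- The given weights are not rounded: they only yield the multiplicity conditions, from which new
  -- weights are built.
  λ rational → balanced⇒half-integral μ μ-sym u (rational⇒balanced μ μ-sym u rational)
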